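{- Let $n\ge 2$ and let $P=[p_1,\ldots,p_n]\neq[n,n-1,\ldots,1]$ be an arithmetically progressed permutation with ratio $k$ such that $p_1\in\{1,k+1,n\}$. Then there exists a string $\mathsf{T}$ of length $n$ over the binary alphabet $\{\mathtt{a},\mathtt{b}\}$ ($\mathtt{a}<\mathtt{b}$) with $\mathsf{SA}_{\mathsf{T}}=P$.
   Context: Lexicographic order with a proper prefix smaller than the longer string; suffix array $\mathsf{SA}_{\mathsf{T}}$: permutation of $[1..n]$ such that $\mathsf{T}[\mathsf{SA}_{\mathsf{T}}[i]..n]$ is the $i$-th smallest suffix. $x\bmod n$ denotes the representative of $x$ modulo $n$ in $[1..n]$. An arithmetically progressed permutation of length $n$ with ratio $k\in[1..n-1]$ is a permutation $P=[p_1,\ldots,p_n]$ of $[1..n]$ with $p_{i+1}=p_i+k\bmod n$. -}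

module Defs where

open import Data.Bool.Base using (Bool; _<_)
open import Data.Bool.Properties using (_<?_)
import Data.Bool.Properties as Bool
open import Data.Fin.Base using (Fin; toℕ)
open import Data.Fin.Permutation using (Permutation′; _⟨$⟩ʳ_)
open import Data.List.Base using (List; allFin; drop; filter; length)
open import Data.List.Relation.Binary.Lex.Strict using (Lex-<; <-decidable)
open import Data.Nat.Base as ℕ using (ℕ; suc; pred; _+_; NonZero)
open import Data.Nat.DivMod using (_%_)
open import Data.Vec.Base using (Vec; toList)
open import Relation.Binary.Core using (Rel)
open import Relation.Binary.Definitions using (Decidable)
open import Relation.Binary.PropositionalEquality.Core using (_≡_)

-- The ordered alphabet {a < b}: false plays the role of a, true that of b.
Letter : Set
Letter = Bool

-- Lexicographic order; a proper prefix is smaller than the longer string.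
infix 4 _<ₗₑₓ_ _<ₗₑₓ?_

_<ₗₑₓ_ : Rel (List Letter) _
_<ₗₑₓ_ = Lex-< _≡_ _<_

_<ₗₑₓ?_ : Decidable _<ₗₑₓ_
_<ₗₑₓ?_ = <-decidable Bool._≟_ _<?_

-- Positions in [1..n] are encoded by Fin n: p stands for suc (toℕ p).
-- suffix T p is therefore T[suc (toℕ p)..n].
suffix : ∀ {n} → Vec Letter n → Fin n → List Letter
suffix T p = drop (toℕ p) (toList T)

-- The number of suffixes of T smaller than the one starting at p. Suffixes
-- starting at different positions have different lengths, so counting
-- starting positions counts suffixes.
rank : ∀ {n} → Vec Letter n → Fin n → ℕ
rank {n} T p = length (filter (λ q → suffix T q <ₗₑₓ? suffix T p) (allFin n))

-- P is the suffix array of T: for every index i, counted from 0, the suffix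
-- starting at P i is the (1 + i)-th smallest, i.e. exactly i suffixes are
-- smaller. Since distinct suffixes have distinct ranks, this determines P.
IsSuffixArray : ∀ {n} → Vec Letter n → Permutation′ n → Set
IsSuffixArray T P = ∀ i → rank T (P ⟨$⟩ʳ i) ≡ toℕ i

-- The entries of P as numbers in [1..n]; the index i is still counted from 0.
entry : ∀ {n} → Permutation′ n → Fin n → ℕ
entry P i = suc (toℕ (P ⟨$⟩ʳ i))

first : ∀ {n} .{{_ : NonZero n}} → Fin n
first {suc _} = Fin.zero

-- The representative of x modulo n in [1..n].
infixl 7 _mod₁_

_mod₁_ : (x n : ℕ) .{{_ : NonZero n}} → ℕ
x mod₁ n = suc ((x + pred n) % n)

record ArithmeticallyProgressed {n : ℕ} .{{_ : NonZero n}}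
                                (k : ℕ) (P : Permutation′ n) : Set where
  field
    1≤ratio : 1 ℕ.≤ k
    ratio<n : k ℕ.< n
    step    : ∀ (i j : Fin n) → toℕ j ≡ suc (toℕ i) →
              entry P j ≡ (entry P i + k) mod₁ n

{-# OPTIONS --safe #-}
-- Colour the positions by P: the letter at P i is b exactly when i exceeds a
-- threshold t. Chopping the first letters off the suffixes at P i and P (i + 1)
-- leaves the suffixes at P i + 1 and P (i + 1) + 1, which again differ by k
-- modulo n and so are again consecutive in P, unless P (i + 1) is the last
-- position of the string or P i + 1 is the last entry of P. The choice of the
-- first entry of P makes these exceptions occur for at most one index i, and
-- t is taken to be that index, where the first letters decide the comparison.
-- So consecutive suffixes compare correctly, by induction on their length.
module Submission where

open import Defs
open import Data.Bool.Base using (true; false; f<t)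
import Data.Bool.Properties as Bool
open import Data.Fin.Base as Fin using (Fin; zero; suc; toℕ; fromℕ; fromℕ<)
open import Data.Fin.Induction using (Acc; acc; >-wellFounded)
open import Data.Fin.Permutation
  using (Permutation′; reverse; _≈_; _⟨$⟩ʳ_; _⟨$⟩ˡ_; inverseˡ; inverseʳ)
open import Data.Fin.Properties
  using (toℕ<n; toℕ-fromℕ; toℕ-fromℕ<; toℕ-inject₁; toℕ-injective; _<?_; <-cmp)
open import Data.List.Base as List using ([]; _∷_; allFin; drop; filter; length)
open import Data.List.Membership.Propositional using (_∈_)
open import Data.List.Membership.Propositional.Properties using (∈-allFin; ∈-map⁺)
open import Data.List.Membership.Propositional.Properties.WithK using (unique∧set⇒bag)
open import Data.List.Properties using (drop-all; filter-none; filter-≐; map-tabulate)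
open import Data.List.Relation.Binary.BagAndSetEquality using (∼bag⇒↭)
open import Data.List.Relation.Binary.Lex.Strict
  using (halt; this; next; <-asymmetric; <-transitive)
open import Data.List.Relation.Binary.Permutation.Propositional using (_↭_)
open import Data.List.Relation.Binary.Permutation.Propositional.Properties
  using (filter-↭; ↭-length)
open import Data.List.Relation.Unary.All.Properties using (tabulate⁺)
open import Data.List.Relation.Unary.Unique.Propositional.Properties using (allFin⁺; map⁺)
open import Data.Nat.Base as ℕ
  using (ℕ; zero; suc; pred; _+_; _∸_; _<ᵇ_; _≤_; NonZero; s≤s; s<s)
open import Data.Nat.DivMod
  using (_%_; _/_; m≡m%n+[m/n]*n; [m+kn]%n≡m%n; [m+n]%n≡m%n; m<n⇒m%n≡m; n%n≡0; %-pred-≡0; %-congˡ)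
import Data.Nat.Properties as ℕ
open import Data.Product.Base using (_,_; proj₁; proj₂; ∃-syntax)
open import Data.Sum.Base using (_⊎_; inj₁; inj₂)
open import Data.Vec.Base as Vec using (Vec; lookup; tabulate; toList)
open import Data.Vec.Properties using (lookup∘tabulate; length-toList)
open import Function.Base using (_∘_)
open import Function.Bundles using (mk⇔)
open import Level using (0ℓ)
open import Relation.Binary.Definitions using (Asymmetric; Transitive; tri<; tri≈; tri>)
open import Relation.Binary.PropositionalEquality.Core
  using (_≡_; _≢_; refl; sym; trans; cong; subst; subst₂)
open import Relation.Binary.PropositionalEquality.Properties
  using (isEquivalence; module ≡-Reasoning)
open import Relation.Nullary.Decidable using (yes; no)
open import Relation.Nullary.Negation using (contradiction)
open import Relation.Nullary.Negation.Core using (¬_)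
open import Relation.Unary using (Pred; Decidable)

private
  variable
    n : ℕ

-- Suffix arrays from comparisons of consecutive suffixes.

<ₗₑₓ-trans : Transitive _<ₗₑₓ_
<ₗₑₓ-trans = <-transitive isEquivalence Bool.<-resp₂-≡ Bool.<-trans

<ₗₑₓ-asym : Asymmetric _<ₗₑₓ_
<ₗₑₓ-asym = <-asymmetric sym Bool.<-resp₂-≡ Bool.<-asym

⟨$⟩ʳ-injective : (P : Permutation′ n) {i j : Fin n} → P ⟨$⟩ʳ i ≡ P ⟨$⟩ʳ j → i ≡ j
⟨$⟩ʳ-injective P eq = trans (sym (inverseˡ P)) (trans (cong (P ⟨$⟩ˡ_) eq) (inverseˡ P))

-- Both lists are duplicate-free and have the same members, since `P` is surjective. This lets
-- `rank` count indices of `P` instead of positions.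
allFin-↭ : (P : Permutation′ n) → allFin n ↭ List.map (P ⟨$⟩ʳ_) (allFin n)
allFin-↭ {n} P = ∼bag⇒↭ (unique∧set⇒bag (allFin⁺ n) (map⁺ (⟨$⟩ʳ-injective P) (allFin⁺ n))
  (λ {x} → mk⇔ (λ _ → subst (_∈ _) (inverseʳ P) (∈-map⁺ (P ⟨$⟩ʳ_) (∈-allFin (P ⟨$⟩ˡ x))))
               (λ _ → ∈-allFin x)))

length-filter-map : ∀ {A B : Set} {Q : Pred B 0ℓ} (Q? : Decidable Q) (f : A → B) xs →
                    length (filter Q? (List.map f xs)) ≡ length (filter (Q? ∘ f) xs)
length-filter-map Q? f []       = refl
length-filter-map Q? f (x ∷ xs) with Q? (f x)
... | yes _ = cong suc (length-filter-map Q? f xs)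
... | no  _ = length-filter-map Q? f xs

below? : (i : Fin n) → Decidable {A = Fin n} (Fin._< i)
below? i = _<? i

count-< : (i : Fin n) → length (filter (below? i) (allFin n)) ≡ toℕ i
count-< {suc n} zero    = cong length
  (filter-none (below? zero) {allFin (suc n)} (tabulate⁺ {n = suc n} {f = λ j → j} λ _ ()))
-- `zero` passes the test by computation, which accounts for the `suc`; the rest is the count for
-- `i`, shifted by one.
count-< {suc n} (suc i) = cong suc (begin
  length (filter (below? (suc i)) (List.tabulate suc))
    ≡⟨ cong (length ∘ filter (below? (suc i))) (map-tabulate {n = n} (λ j → j) suc) ⟨
  length (filter (below? (suc i)) (List.map suc (allFin n)))
    ≡⟨ length-filter-map (below? (suc i)) suc (allFin n) ⟩
  length (filter (below? (suc i) ∘ suc) (allFin n))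
    ≡⟨ cong length (filter-≐ _ (below? i) (ℕ.s<s⁻¹ , s<s) (allFin n)) ⟩
  length (filter (below? i) (allFin n))
    ≡⟨ count-< i ⟩
  toℕ i ∎)
  where open ≡-Reasoning

module _ (T : Vec Letter n) (P : Permutation′ n)
         (sorted : ∀ i j → toℕ j ≡ suc (toℕ i) → suffix T (P ⟨$⟩ʳ i) <ₗₑₓ suffix T (P ⟨$⟩ʳ j))
         where

  -- `d` is one less than the gap between the indices, so that `sorted` is the base case; longer
  -- gaps chain by transitivity.
  suffix-mono : ∀ d i j → toℕ j ≡ suc (d + toℕ i) → suffix T (P ⟨$⟩ʳ i) <ₗₑₓ suffix T (P ⟨$⟩ʳ j)
  suffix-mono zero    i j eq = sorted i j eq
  suffix-mono (suc d) i j eq = <ₗₑₓ-trans (sorted i i′ toℕ-i′) (suffix-mono d i′ j eq′)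
    where
    i+1<n : suc (toℕ i) ℕ.< _
    i+1<n = ℕ.≤-<-trans (subst (suc (toℕ i) ≤_) (sym eq) (s≤s (ℕ.m≤n+m _ (suc d)))) (toℕ<n j)
    i′ = fromℕ< i+1<n
    toℕ-i′ : toℕ i′ ≡ suc (toℕ i)
    toℕ-i′ = toℕ-fromℕ< i+1<n
    eq′ : toℕ j ≡ suc (d + toℕ i′)
    eq′ = trans eq (cong suc (trans (sym (ℕ.+-suc d _)) (cong (d +_) (sym toℕ-i′))))

  suffix-mono-< : ∀ {i j} → i Fin.< j → suffix T (P ⟨$⟩ʳ i) <ₗₑₓ suffix T (P ⟨$⟩ʳ j)
  suffix-mono-< {i} {j} i<j = suffix-mono (toℕ j ∸ suc (toℕ i)) i j
    (trans (sym (ℕ.m∸n+n≡m i<j)) (ℕ.+-suc _ _))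

  suffix-cancel-< : ∀ {i j} → suffix T (P ⟨$⟩ʳ i) <ₗₑₓ suffix T (P ⟨$⟩ʳ j) → i Fin.< j
  suffix-cancel-< {i} {j} lt with <-cmp i j
  ... | tri< i<j _ _    = i<j
  ... | tri≈ _ refl _   = contradiction lt (<ₗₑₓ-asym lt)
  ... | tri> _ _ j<i    = contradiction lt (<ₗₑₓ-asym (suffix-mono-< j<i))

  -- By monotonicity and its converse, comparing suffixes amounts to comparing their indices in `P`,
  -- so after reindexing by `P` the rank counts the indices below `i`.
  sorted⇒isSuffixArray : IsSuffixArray T P
  sorted⇒isSuffixArray i = begin
    length (filter smaller? (allFin n))
      ≡⟨ ↭-length (filter-↭ smaller? (allFin-↭ P)) ⟩
    length (filter smaller? (List.map (P ⟨$⟩ʳ_) (allFin n)))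
      ≡⟨ length-filter-map smaller? (P ⟨$⟩ʳ_) (allFin n) ⟩
    length (filter (smaller? ∘ (P ⟨$⟩ʳ_)) (allFin n))
      ≡⟨ cong length (filter-≐ _ (below? i) (suffix-cancel-< , suffix-mono-<) (allFin n)) ⟩
    length (filter (below? i) (allFin n))
      ≡⟨ count-< i ⟩
    toℕ i ∎
    where
    open ≡-Reasoning
    smaller? = λ q → suffix T q <ₗₑₓ? suffix T (P ⟨$⟩ʳ i)

-- First letters, the threshold test and remainders.

suffix-∷ : (T : Vec Letter n) (p : Fin n) →
           suffix T p ≡ lookup T p ∷ drop (suc (toℕ p)) (toList T)
suffix-∷ (x Vec.∷ T) zero    = refl
suffix-∷ (x Vec.∷ T) (suc p) = suffix-∷ T p

[]<drop : (T : Vec Letter n) {p : ℕ} → p ℕ.< n → [] <ₗₑₓ drop p (toList T)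
[]<drop (x Vec.∷ T) {zero}  _         = halt
[]<drop (x Vec.∷ T) {suc p} (s<s p<n) = []<drop T p<n

n<ᵇn≡false : ∀ t → (t <ᵇ t) ≡ false
n<ᵇn≡false zero    = refl
n<ᵇn≡false (suc t) = n<ᵇn≡false t

n<ᵇ1+n≡true : ∀ t → (t <ᵇ suc t) ≡ true
n<ᵇ1+n≡true zero    = refl
n<ᵇ1+n≡true (suc t) = n<ᵇ1+n≡true t

-- Consecutive indices away from the threshold thus carry equal letters, which leaves the comparison
-- to the tails.
<ᵇ-suc-≢ : ∀ {i t} → i ≢ t → (t <ᵇ i) ≡ (t <ᵇ suc i)
<ᵇ-suc-≢ {zero}  {zero}  i≢t = contradiction refl i≢t
<ᵇ-suc-≢ {zero}  {suc t} i≢t = refl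
<ᵇ-suc-≢ {suc i} {zero}  i≢t = refl
<ᵇ-suc-≢ {suc i} {suc t} i≢t = <ᵇ-suc-≢ (i≢t ∘ cong suc)

suc-% : ∀ x n .{{_ : NonZero n}} → suc (x % n) ℕ.< n → suc x % n ≡ suc (x % n)
suc-% x n lt = begin
  suc x % n                         ≡⟨ %-congˡ {o = n} (cong suc (m≡m%n+[m/n]*n x n)) ⟩
  (suc (x % n) + (x / n) ℕ.* n) % n ≡⟨ [m+kn]%n≡m%n (suc (x % n)) (x / n) n ⟩
  suc (x % n) % n                   ≡⟨ m<n⇒m%n≡m lt ⟩
  suc (x % n)                       ∎
  where open ≡-Reasoning

toℕ-pred : (i : Fin n) → toℕ (Fin.pred i) ≡ pred (toℕ i)
toℕ-pred zero    = refl
toℕ-pred (suc i) = toℕ-inject₁ i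

-- Progressed permutations and the threshold text.

module _ {m k : ℕ} (P : Permutation′ (suc m)) (ap : ArithmeticallyProgressed k P) where
  open ArithmeticallyProgressed ap

  pos : Fin (suc m) → ℕ
  pos i = toℕ (P ⟨$⟩ʳ i)

  -- The shift by `pred n` in `mod₁` and the `suc` in `entry` add up to a full `n`, which vanishes
  -- modulo `n`.
  pos-step : ∀ i j → toℕ j ≡ suc (toℕ i) → pos j ≡ (pos i + k) % suc m
  pos-step i j i+1≡j = trans (ℕ.suc-injective (step i j i+1≡j))
    (trans (%-congˡ {o = suc m} (sym (ℕ.+-suc (pos i + k) m))) ([m+n]%n≡m%n (pos i + k) (suc m)))

  pos-injective : ∀ {i j} → pos i ≡ pos j → i ≡ j
  pos-injective = ⟨$⟩ʳ-injective P ∘ toℕ-injective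

  pos-⟨$⟩ˡ : ∀ p → pos (P ⟨$⟩ˡ p) ≡ toℕ p
  pos-⟨$⟩ˡ p = cong toℕ (inverseʳ P)

  successor : ∀ i → toℕ i ≢ m → ∃[ j ] toℕ j ≡ suc (toℕ i)
  successor i i≢m = fromℕ< i+1<n , toℕ-fromℕ< i+1<n
    where i+1<n = s<s (ℕ.≤∧≢⇒< (ℕ.s≤s⁻¹ (toℕ<n i)) i≢m)

  -- Otherwise the entry after index `j` would repeat the one at index `zero`, against injectivity.
  wraps⇒last : ∀ j → (pos j + k) % suc m ≡ pos zero → toℕ j ≡ m
  wraps⇒last j wraps with toℕ j ℕ.≟ m
  ... | yes j≡m = j≡m
  ... | no  j≢m with j′ , j+1≡j′ ← successor j j≢m
      with refl ← pos-injective {j′} {zero} (trans (pos-step j j′ j+1≡j′) wraps)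
      with () ← j+1≡j′

  -- Each field confines one obstruction to `t`: in `end-of-T` the suffix at `pos j` has an empty
  -- tail, in `end-of-P` the position after `pos i` has no next entry in `P`. Neither has to occur.
  record OnlyExceptionAt (t : ℕ) : Set where
    field
      end-of-T : ∀ (i j : Fin (suc m)) → toℕ j ≡ suc (toℕ i) → pos j ≡ m → toℕ i ≡ t
      end-of-P : ∀ (i j l : Fin (suc m)) → toℕ j ≡ suc (toℕ i) → toℕ l ≡ m →
                 pos l ≡ suc (pos i) → toℕ i ≡ t

  module _ (t : ℕ) (exception : OnlyExceptionAt t) where
    open OnlyExceptionAt exception

    text : Vec Letter (suc m)
    text = tabulate (λ p → t <ᵇ toℕ (P ⟨$⟩ˡ p))

    lookup-text : ∀ i → lookup text (P ⟨$⟩ʳ i) ≡ (t <ᵇ toℕ i)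
    lookup-text i = trans (lookup∘tabulate (λ p → t <ᵇ toℕ (P ⟨$⟩ˡ p)) (P ⟨$⟩ʳ i))
                          (cong (λ j → t <ᵇ toℕ j) (inverseˡ P {i}))

    suffix-pos : ∀ i → suffix text (P ⟨$⟩ʳ i) ≡ (t <ᵇ toℕ i) ∷ drop (suc (pos i)) (toList text)
    suffix-pos i = trans (suffix-∷ text (P ⟨$⟩ʳ i)) (cong (_∷ drop (suc (pos i)) (toList text)) (lookup-text i))

    -- The recursion is on growing positions, not on indices: it moves to position `pos i + 1`,
    -- whose index may lie on either side of `i`.
    text-sorted : ∀ i j → Acc Fin._>_ (P ⟨$⟩ʳ i) → toℕ j ≡ suc (toℕ i) →
                  suffix text (P ⟨$⟩ʳ i) <ₗₑₓ suffix text (P ⟨$⟩ʳ j)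
    text-sorted i j (acc rs) i+1≡j with toℕ i ℕ.≟ t
    ... | yes refl rewrite suffix-pos i | suffix-pos j | i+1≡j
                         | n<ᵇn≡false (toℕ i) | n<ᵇ1+n≡true (toℕ i) = this f<t
    ... | no i≢t = subst₂ _<ₗₑₓ_ (sym (suffix-pos i)) (sym (suffix-pos j))
                     (next (trans (<ᵇ-suc-≢ i≢t) (cong (t <ᵇ_) (sym i+1≡j))) tails<)
      where
      pos-j+1<n : suc (pos j) ℕ.< suc m
      pos-j+1<n = s<s (ℕ.≤∧≢⇒< (ℕ.s≤s⁻¹ (toℕ<n _)) (i≢t ∘ end-of-T i j i+1≡j))

      tails< : drop (suc (pos i)) (toList text) <ₗₑₓ drop (suc (pos j)) (toList text)
      tails< with pos i ℕ.≟ m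
      -- The tail at `pos i` is empty, hence a proper prefix of the other tail, which is nonempty by
      -- `pos-j+1<n`.
      ... | yes pos-i≡m
          rewrite drop-all (suc (pos i)) (toList text)
                    (ℕ.≤-reflexive (trans (length-toList text) (cong suc (sym pos-i≡m))))
          = []<drop text pos-j+1<n
      ... | no pos-i≢m = subst₂ (λ p q → drop p (toList text) <ₗₑₓ drop q (toList text))
                           pos-i′ pos-j′ (text-sorted i′ j′ (rs (ℕ.≤-reflexive (sym pos-i′))) i′+1≡j′)
        where
        pos-i+1<n : suc (pos i) ℕ.< suc m
        pos-i+1<n = s<s (ℕ.≤∧≢⇒< (ℕ.s≤s⁻¹ (toℕ<n _)) pos-i≢m)
        i′ = P ⟨$⟩ˡ fromℕ< pos-i+1<n
        pos-i′ : pos i′ ≡ suc (pos i)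
        pos-i′ = trans (pos-⟨$⟩ˡ _) (toℕ-fromℕ< pos-i+1<n)
        next-i′ = successor i′ λ i′≡m → i≢t (end-of-P i j i′ i+1≡j i′≡m pos-i′)
        j′ = proj₁ next-i′
        i′+1≡j′ = proj₂ next-i′
        -- Since `pos j` is not the last position, adding 1 causes no wrap-around and the step by
        -- `k` is preserved.
        pos-j′ : pos j′ ≡ suc (pos j)
        pos-j′ = begin
          pos j′                        ≡⟨ pos-step i′ j′ i′+1≡j′ ⟩
          (pos i′ + k) % suc m          ≡⟨ cong (λ p → (p + k) % suc m) pos-i′ ⟩
          suc (pos i + k) % suc m       ≡⟨ suc-% (pos i + k) (suc m)
                                             (subst (λ p → suc p ℕ.< suc m) (pos-step i j i+1≡j) pos-j+1<n) ⟩
          suc ((pos i + k) % suc m)     ≡⟨ cong suc (pos-step i j i+1≡j) ⟨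
          suc (pos j)                   ∎
          where open ≡-Reasoning

    suffixArray-exists : ∃[ T ] IsSuffixArray {suc m} T P
    suffixArray-exists = text , sorted⇒isSuffixArray text P
      (λ i j → text-sorted i j (>-wellFounded (P ⟨$⟩ʳ i)))

  -- The threshold for each of the three first entries.

  beforeEnd : ℕ
  -- If position `m` has index 0, `pred` returns 0; no index precedes it then, and `end-of-T` holds
  -- vacuously.
  beforeEnd = pred (toℕ (P ⟨$⟩ˡ fromℕ m))

  pos≡m⇒beforeEnd : ∀ (i j : Fin (suc m)) → toℕ j ≡ suc (toℕ i) → pos j ≡ m → toℕ i ≡ beforeEnd
  pos≡m⇒beforeEnd i j i+1≡j pos-j≡m = begin
    toℕ i                              ≡⟨ cong pred i+1≡j ⟨
    pred (toℕ j)                       ≡⟨ cong (pred ∘ toℕ) (pos-injective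
                                            (trans pos-j≡m (sym (trans (pos-⟨$⟩ˡ (fromℕ m)) (toℕ-fromℕ m))))) ⟩
    beforeEnd                          ∎
    where open ≡-Reasoning

  -- A step by `k` leads back to the first entry only from the last index, so this identifies the
  -- last entry of `P`.
  wraps⇒≡last : ∀ p l → (toℕ p + k) % suc m ≡ pos zero → toℕ l ≡ m → pos l ≡ toℕ p
  wraps⇒≡last p l wraps l≡m = trans (cong pos (toℕ-injective (trans l≡m (sym last)))) (pos-⟨$⟩ˡ p)
    where
    last : toℕ (P ⟨$⟩ˡ p) ≡ m
    last = wraps⇒last (P ⟨$⟩ˡ p) (trans (cong (λ q → (q + k) % suc m) (pos-⟨$⟩ˡ p)) wraps)

  -- Here P ends in the entry n + 1 − k, at 0-based position n − k, so both exceptions are at the same index.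
  first≡1 : pos zero ≡ 0 → OnlyExceptionAt beforeEnd
  first≡1 pos-0≡0 = record
    { end-of-T = pos≡m⇒beforeEnd
    ; end-of-P = λ i j l i+1≡j l≡m pos-l → pos≡m⇒beforeEnd i j i+1≡j
        -- The remainder of `pos i + k` is `m` because the next number, `pos l + k`, has remainder
        -- 0.
        (trans (pos-step i j i+1≡j) (%-pred-≡0 {pos i + k} {suc m} (begin
          (suc (pos i) + k) % suc m     ≡⟨ cong (λ p → (p + k) % suc m) pos-l ⟨
          (pos l + k) % suc m           ≡⟨ cong (λ p → (p + k) % suc m) (wraps⇒≡last q l
                                             (trans wraps (sym pos-0≡0)) l≡m) ⟩
          (toℕ q + k) % suc m           ≡⟨ wraps ⟩
          0                             ∎)))
    }
    where
    open ≡-Reasoning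
    n∸k<n : suc m ∸ k ℕ.< suc m
    n∸k<n = ℕ.∸-monoʳ-< 1≤ratio (ℕ.<⇒≤ ratio<n)
    q = fromℕ< n∸k<n
    wraps : (toℕ q + k) % suc m ≡ 0
    wraps = begin
      (toℕ q + k) % suc m      ≡⟨ cong (λ p → (p + k) % suc m) (toℕ-fromℕ< n∸k<n) ⟩
      (suc m ∸ k + k) % suc m  ≡⟨ %-congˡ {o = suc m} (ℕ.m∸n+n≡m (ℕ.<⇒≤ ratio<n)) ⟩
      suc m % suc m            ≡⟨ n%n≡0 (suc m) ⟩
      0                        ∎

  -- Here P ends in the entry 1, which is not the successor of a position.
  first≡k+1 : pos zero ≡ k → OnlyExceptionAt beforeEnd
  first≡k+1 pos-0≡k = record
    { end-of-T = pos≡m⇒beforeEnd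
    ; end-of-P = λ i j l i+1≡j l≡m pos-l → contradiction
        (trans (sym pos-l) (wraps⇒≡last zero l (trans (m<n⇒m%n≡m ratio<n) (sym pos-0≡k)) l≡m))
        λ ()
    }

  -- Position `m` is the first entry and so follows no other, which leaves only `end-of-P`. The
  -- threshold is the index of the position just before the last entry of `P`. If that entry is
  -- position 0, `Fin.pred` keeps 0 and `end-of-P` is vacuous.
  first≡n : pos zero ≡ m → OnlyExceptionAt (toℕ (P ⟨$⟩ˡ Fin.pred (P ⟨$⟩ʳ fromℕ m)))
  first≡n pos-0≡m = record
    { end-of-T = λ i j i+1≡j pos-j≡m → contradiction
        (trans (sym i+1≡j) (cong toℕ (pos-injective {j} {zero} (trans pos-j≡m (sym pos-0≡m)))))
        λ ()
    ; end-of-P = λ i j l i+1≡j l≡m pos-l → cong toℕ (pos-injective (begin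
        pos i                                  ≡⟨ cong pred pos-l ⟨
        pred (pos l)                           ≡⟨ cong (pred ∘ pos)
                                                    (toℕ-injective (trans l≡m (sym (toℕ-fromℕ m)))) ⟩
        pred (pos (fromℕ m))                   ≡⟨ toℕ-pred (P ⟨$⟩ʳ fromℕ m) ⟨
        toℕ (Fin.pred (P ⟨$⟩ʳ fromℕ m))        ≡⟨ pos-⟨$⟩ˡ _ ⟨
        pos (P ⟨$⟩ˡ Fin.pred (P ⟨$⟩ʳ fromℕ m)) ∎))
    }
    where open ≡-Reasoning

theorem9 : (n : ℕ) .{{_ : NonZero n}} → 2 ≤ n →
    (k : ℕ) (P : Permutation′ n) →
    ArithmeticallyProgressed k P →
    ¬ (P ≈ reverse) →
    entry P first ≡ 1 ⊎ entry P first ≡ suc k ⊎ entry P first ≡ n →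
    ∃[ T ] IsSuffixArray {n} T P
-- The entries 1, `k + 1` and `n` are the 0-based positions 0, `k` and `m`; the threshold is
-- inferred from the lemma for the case.
theorem9 (suc m) _ k P ap _ (inj₁ first-1) =
  suffixArray-exists P ap _ (first≡1 P ap (ℕ.suc-injective first-1))
theorem9 (suc m) _ k P ap _ (inj₂ (inj₁ first-k+1)) =
  suffixArray-exists P ap _ (first≡k+1 P ap (ℕ.suc-injective first-k+1))
theorem9 (suc m) _ k P ap _ (inj₂ (inj₂ first-n)) =
  suffixArray-exists P ap _ (first≡n P ap (ℕ.suc-injective first-n))
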